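{- Let $n>0$ and $J\subseteq S$. The restriction of the weak order $\leq_S$ to the set $\mathfrak{S}_n^J(231)$ is a lattice, denoted $\mathcal{T}_n^J$. Although $\mathcal{T}_n^J$ is in general not a sublattice of $\mathrm{Weak}(\mathfrak{S}_n^J)$, it is a lattice quotient of $\mathrm{Weak}(\mathfrak{S}_n^J)$, i.e. there is a lattice congruence $\Theta$ on $\mathrm{Weak}(\mathfrak{S}_n^J)$ such that the quotient lattice $\mathrm{Weak}(\mathfrak{S}_n^J)/\Theta$ is isomorphic to $\mathcal{T}_n^J$.
   Context: Let $\mathfrak{S}_n$ be the symmetric group on $[n]=\{1,\dots,n\}$, $s_i=(i,i+1)$ for $i\in[n-1]$, and $S=\{s_1,\dots,s_{n-1}\}$. Write permutations in one-line notation $w=w_1w_2\cdots w_n$ with $w_i=w(i)$. The inversion set is $\mathrm{inv}(w)=\{(i,j):1\le i<j\le n,\ w_i>w_j\}$ and the (left) weak order is $u\le_S v$ iff $\mathrm{inv}(u)\subseteq\mathrm{inv}(v)$. For $J\subseteq S$, the parabolic quotient is $\mathfrak{S}_n^J=\{w\in\mathfrak{S}_n : w<_S ws\text{ for all }s\in J\}$ (concretely: $w_i<w_{i+1}$ whenever $s_i\in J$); $\mathrm{Weak}(\mathfrak{S}_n^J)$ is $\mathfrak{S}_n^J$ with the restricted order, which is a lattice (it is the weak order interval $[e,w_\circ^J]$). Writing $J=S\setminus\{s_{j_1},\dots,s_{j_r}\}$ with $j_1<\dots<j_r$, the $J$-regions are the blocks $\{1,\dots,j_1\},\{j_1+1,\dots,j_2\},\dots,\{j_r+1,\dots,n\}$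 of $[n]$. An element $w\in\mathfrak{S}_n^J$ contains a $(J,231)$-pattern if there are indices $i<j<k$, lying in three pairwise different $J$-regions, with $w_k<w_i<w_j$ and $w_i=w_k+1$; otherwise $w$ is $(J,231)$-avoiding, and $\mathfrak{S}_n^J(231)$ denotes the set of $(J,231)$-avoiding elements of $\mathfrak{S}_n^J$. A lattice congruence on a lattice $L$ is an equivalence relation $\Theta$ such that $x\,\Theta\, y$ implies $(x\wedge z)\,\Theta\,(y\wedge z)$ and $(x\vee z)\,\Theta\,(y\vee z)$ for all $z$; the quotient $L/\Theta$ carries the induced lattice operations. -}

module Defs where

open import Algebra.Core using (Op₂)
import Algebra.Lattice as Alg
open import Algebra.Lattice.Morphism.Structures using (IsLatticeIsomorphism)
open import Data.Fin.Base using (Fin; zero; suc; inject₁; toℕ; _<_)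
open import Data.Fin.Permutation as Perm using (Permutation′; _⟨$⟩ʳ_)
open import Data.Fin.Subset using (Subset; inside; outside; _∈_)
open import Data.Nat.Base using (ℕ; suc)
open import Data.Product.Base using (Σ; ∃-syntax; _×_; _,_; proj₁; proj₂)
open import Data.Vec.Base using (_∷_)
open import Function.Base using (_on_)
open import Level using (0ℓ)
open import Relation.Binary.Core using (Rel; _⇒_)
open import Relation.Binary.Lattice using (Lattice; IsLattice)
import Relation.Binary.Lattice.Properties.Lattice as LatticeProperties
open import Relation.Binary.PropositionalEquality.Core using (_≡_; _≢_)
open import Relation.Binary.Structures using (IsEquivalence)
open import Relation.Nullary.Negation.Core using (¬_)
open import Relation.Unary using (Pred; _⊆_)

-- "The order _≤_ is a lattice"; IsLattice includes being a partial order.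
-- The operations are determined by the order up to _≈_.
record LatticeOrder {A : Set} (_≈_ _≤_ : Rel A 0ℓ) : Set where
  field
    _∨_       : Op₂ A
    _∧_       : Op₂ A
    isLattice : IsLattice _≈_ _≤_ _∨_ _∧_

  lattice : Lattice 0ℓ 0ℓ 0ℓ
  lattice = record { isLattice = isLattice }

  algLattice : Alg.Lattice 0ℓ 0ℓ
  algLattice = LatticeProperties.algLattice lattice

module _ (L : Lattice 0ℓ 0ℓ 0ℓ) where
  open Lattice L

  IsSublattice : Pred Carrier 0ℓ → Set
  IsSublattice P = ∀ x y → P x → P y → P (x ∧ y) × P (x ∨ y)

  -- The field `reflexive` says that Θ is a relation on elements up to _≈_.
  record IsLatticeCongruence (_Θ_ : Rel Carrier 0ℓ) : Set where
    field
      isEquivalence : IsEquivalence _Θ_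
      reflexive     : _≈_ ⇒ _Θ_
      ∧-congʳ       : ∀ {x y} z → x Θ y → (x ∧ z) Θ (y ∧ z)
      ∨-congʳ       : ∀ {x y} z → x Θ y → (x ∨ z) Θ (y ∨ z)

-- L / Θ has the carrier and the operations of L, and Θ as its equality.
quotient : (L : Lattice 0ℓ 0ℓ 0ℓ) {Θ : Rel (Lattice.Carrier L) 0ℓ} →
           IsLatticeCongruence L Θ → Alg.Lattice 0ℓ 0ℓ
quotient L {Θ} cong = record
  { _≈_       = Θ
  ; _∨_       = _∨_
  ; _∧_       = _∧_
  ; isLattice = record
    { isEquivalence = C.isEquivalence
    ; ∨-comm        = λ x y → C.reflexive (A.∨-comm x y)
    ; ∨-assoc       = λ x y z → C.reflexive (A.∨-assoc x y z)
    ; ∨-cong        = λ {x} {y} {u} {v} p q →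
        E.trans (C.∨-congʳ u p)
          (E.trans (C.reflexive (A.∨-comm y u))
            (E.trans (C.∨-congʳ y q) (C.reflexive (A.∨-comm v y))))
    ; ∧-comm        = λ x y → C.reflexive (A.∧-comm x y)
    ; ∧-assoc       = λ x y z → C.reflexive (A.∧-assoc x y z)
    ; ∧-cong        = λ {x} {y} {u} {v} p q →
        E.trans (C.∧-congʳ u p)
          (E.trans (C.reflexive (A.∧-comm y u))
            (E.trans (C.∧-congʳ y q) (C.reflexive (A.∧-comm v y))))
    ; absorptive    = (λ x y → C.reflexive (A.∨-absorbs-∧ x y))
                    , (λ x y → C.reflexive (A.∧-absorbs-∨ x y))
    }
  }
  where
  open Lattice L using (_∨_; _∧_)
  module A = Alg.Lattice (LatticeProperties.algLattice L)
  module C = IsLatticeCongruence cong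
  module E = IsEquivalence C.isEquivalence

infix 4 _≅_

_≅_ : Alg.Lattice 0ℓ 0ℓ → Alg.Lattice 0ℓ 0ℓ → Set
K ≅ L = ∃[ f ] IsLatticeIsomorphism (Alg.Lattice.rawLattice K) (Alg.Lattice.rawLattice L) f

-- Positions and values are 0-based.
inv : ∀ {n} → Permutation′ n → Pred (Fin n × Fin n) 0ℓ
inv w (i , j) = i < j × (w ⟨$⟩ʳ j) < (w ⟨$⟩ʳ i)

infix 4 _≤S_

_≤S_ : ∀ {n} → Rel (Permutation′ n) 0ℓ
u ≤S v = inv u ⊆ inv v

-- The degree is n = suc m > 0.  The index i : Fin m stands for the simple
-- transposition of the adjacent positions inject₁ i and suc i, so that a
-- set J of simple transpositions is a Subset m.

InParabolicQuotient : ∀ {m} → Subset m → Pred (Permutation′ (suc m)) 0ℓ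
InParabolicQuotient J w = ∀ i → i ∈ J → (w ⟨$⟩ʳ inject₁ i) < (w ⟨$⟩ʳ suc i)

ParabolicQuotient : ∀ {m} → Subset m → Set
ParabolicQuotient J = Σ (Permutation′ _) (InParabolicQuotient J)

-- Permutations are compared pointwise, and membership proofs are ignored.
module Weak {m} (J : Subset m) where

  infix 4 _≈_ _≤_

  _≈_ : Rel (ParabolicQuotient J) 0ℓ
  _≈_ = Perm._≈_ on proj₁

  _≤_ : Rel (ParabolicQuotient J) 0ℓ
  _≤_ = _≤S_ on proj₁

-- The 0-based number of the J-region containing a position: a new region
-- starts at position suc i exactly when the i-th transposition is not in J.
region : ∀ {m} → Subset m → Fin (suc m) → ℕ
region J             zero    = 0
region (inside  ∷ J) (suc p) = region J p
region (outside ∷ J) (suc p) = suc (region J p)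

record Contains231 {m} (J : Subset m) (w : Permutation′ (suc m)) : Set where
  field
    i j k   : Fin (suc m)
    i<j     : i < j
    j<k     : j < k
    rᵢ≢rⱼ   : region J i ≢ region J j
    rⱼ≢rₖ   : region J j ≢ region J k
    rᵢ≢rₖ   : region J i ≢ region J k
    wₖ<wᵢ   : (w ⟨$⟩ʳ k) < (w ⟨$⟩ʳ i)
    wᵢ<wⱼ   : (w ⟨$⟩ʳ i) < (w ⟨$⟩ʳ j)
    wᵢ≡wₖ+1 : toℕ (w ⟨$⟩ʳ i) ≡ suc (toℕ (w ⟨$⟩ʳ k))

Avoids231 : ∀ {m} (J : Subset m) → Pred (ParabolicQuotient J) 0ℓ
Avoids231 J (w , _) = ¬ Contains231 J w

ParabolicQuotient231 : ∀ {m} → Subset m → Set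
ParabolicQuotient231 J = Σ (ParabolicQuotient J) (Avoids231 J)

module Tamari {m} (J : Subset m) where

  infix 4 _≈_ _≤_

  _≈_ : Rel (ParabolicQuotient231 J) 0ℓ
  _≈_ = Weak._≈_ J on proj₁

  _≤_ : Rel (ParabolicQuotient231 J) 0ℓ
  _≤_ = Weak._≤_ J on proj₁

WeakIsLattice : ∀ {m} → Subset m → Set
WeakIsLattice J = LatticeOrder (Weak._≈_ J) (Weak._≤_ J)

TamariIsLattice : ∀ {m} → Subset m → Set
TamariIsLattice J = LatticeOrder (Tamari._≈_ J) (Tamari._≤_ J)

IsLatticeQuotientOf : ∀ {m} {J : Subset m} → TamariIsLattice J → WeakIsLattice J → Set₁
IsLatticeQuotientOf {J = J} T W =
  Σ (Rel (ParabolicQuotient J) 0ℓ) λ Θ →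
  Σ (IsLatticeCongruence (LatticeOrder.lattice W) Θ) λ cong →
  quotient (LatticeOrder.lattice W) cong ≅ LatticeOrder.algLattice T

{-# OPTIONS --safe #-}

-- Inversion sets are the transitive and cotransitive subsets of {i < j}, so joins
-- in the weak order are transitive closures of unions, meets are dual, and a
-- parabolic quotient is closed under both.
--
-- The join-irreducible permutations are encoded by arcs: positions i < k and a
-- set R of intermediate positions, whose values lie above the descent from i to k
-- while the remaining ones lie below it.  Call an arc contracted if R meets a
-- region different from those of i and k.  A contracted arc stays contracted
-- when it is prolonged, and this makes "the same uncontracted arcs lie below x
-- and y" a lattice congruence.  The join of the uncontracted arcs below x is the
-- least element of the class of x, and the (J,231)-avoiding permutations are
-- exactly these least elements: all descents of such a permutation between
-- consecutive values are uncontracted arcs, and their join is the permutation.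
module Submission where

open import Defs
open import Data.Fin.Base using (Fin; zero; suc; inject₁; toℕ; fromℕ<; punchOut; _<_; _≤_)
open import Data.Fin.Induction using (<-weakInduction; >-wellFounded; <-wellFounded; Acc; acc)
open import Data.Fin.Patterns using (0F; 1F; 2F; 3F)
open import Data.Fin.Permutation as Perm using (Permutation′; _⟨$⟩ʳ_; _⟨$⟩ˡ_)
open import Data.Fin.Properties as Fin using (_≟_; _<?_; any?; all?; <-cmp; <⇒≢)
open import Data.Fin.Subset using (Subset; inside; outside; _∈_; _∉_; ∣_∣; ⊤)
open import Data.Fin.Subset.Properties using (_∈?_; p⊂q⇒∣p∣<∣q∣; ∣⊤∣≡n; ∈⊤; anySubset?)
open import Data.Nat.Base as ℕ using (ℕ; suc)
import Data.Nat.Induction as ℕ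
import Data.Nat.Properties as ℕ
open import Data.Product.Base using (Σ-syntax; ∃-syntax; _×_; _,_; proj₁; proj₂)
open import Data.Sum.Base as Sum using (_⊎_; inj₁; inj₂; [_,_]′)
open import Data.Vec.Base using (Vec; []; _∷_; lookup; tabulate)
open import Data.Vec.Properties using (lookup⇒[]=; []=⇒lookup; lookup∘tabulate)
open import Function.Base using (_∘_; flip)
open import Function.Definitions using (Injective)
open import Level using (0ℓ)
open import Relation.Binary.Core using (Rel; _⇒_)
open import Relation.Binary.Construct.Closure.Transitive using (TransClosure; [_]; _∷_; _++_)
open import Relation.Binary.Definitions using (Transitive; tri<; tri≈; tri>)
import Relation.Binary.Definitions as B
open import Relation.Binary.Lattice using (IsLattice)
open import Relation.Binary.PropositionalEquality using (_≡_; _≢_; refl; sym; trans; cong; subst; subst₂; isEquivalence)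
open import Relation.Binary.Structures using (IsStrictTotalOrder)
open import Relation.Binary.Structures.Biased using (isStrictTotalOrderᶜ)
open import Relation.Nullary.Decidable using (Dec; yes; no; True; toWitness; from-yes; does; dec-true; map′; ¬?; _×-dec_; _⊎-dec_; _→-dec_)
open import Relation.Nullary.Negation.Core using (¬_; contradiction)
open import Relation.Unary using (Pred; Decidable)

private
  variable
    n : ℕ

-- Permutations and total orders

module _ {P : Pred (Fin n) 0ℓ} (P? : Decidable P) where

  comprehension : Subset n
  comprehension = tabulate (does ∘ P?)

  ∈-comprehension⁺ : ∀ {i} → P i → i ∈ comprehension
  ∈-comprehension⁺ {i} p = lookup⇒[]= i _ (trans (lookup∘tabulate _ i) (dec-true (P? i) p))

  ∈-comprehension⁻ : ∀ {i} → i ∈ comprehension → P i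
  ∈-comprehension⁻ {i} i∈ with P? i | trans (sym (lookup∘tabulate (does ∘ P?) i)) ([]=⇒lookup i∈)
  ... | yes p | _  = p
  ... | no  _ | ()

-- Pigeonhole: if `y` were missed, punching it out would inject `Fin n` into a set with one element
-- fewer.
injective⇒surjective : (f : Fin n → Fin n) → Injective _≡_ _≡_ f → ∀ y → ∃[ x ] f x ≡ y
injective⇒surjective {suc _} f f-inj y with any? (λ x → f x ≟ y)
... | yes hit  = hit
... | no  miss = contradiction
  (Fin.injective⇒≤ {f = λ x → punchOut (y≢f x)} (f-inj ∘ Fin.punchOut-injective (y≢f _) (y≢f _)))
  (ℕ.<-irrefl refl)
  where
  y≢f : ∀ x → y ≢ f x
  y≢f x y≡fx = miss (x , sym y≡fx)

injective⇒permutation : (f : Fin n → Fin n) → Injective _≡_ _≡_ f → Permutation′ n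
injective⇒permutation f f-inj = Perm.permutation f (proj₁ ∘ surj) (proj₂ ∘ surj)
  (λ x → f-inj (proj₂ (surj (f x))))
  where surj = injective⇒surjective f f-inj

module Ranking {_≺_ : Rel (Fin n) 0ℓ} (isSTO : IsStrictTotalOrder _≡_ _≺_) where
  private module O = IsStrictTotalOrder isSTO

  predecessors : Fin n → Subset n
  predecessors i = comprehension (λ j → j O.<? i)

  i∉predecessors : ∀ i → i ∉ predecessors i
  i∉predecessors i i∈ = O.irrefl refl (∈-comprehension⁻ (O._<? i) i∈)

  rank-mono : ∀ {i j} → i ≺ j → ∣ predecessors i ∣ ℕ.< ∣ predecessors j ∣
  rank-mono {i} {j} i≺j = p⊂q⇒∣p∣<∣q∣
    ( (λ h∈ → ∈-comprehension⁺ (O._<? j) (O.trans (∈-comprehension⁻ (O._<? i) h∈) i≺j))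
    , i , ∈-comprehension⁺ (O._<? j) i≺j , i∉predecessors i)

  rank<n : ∀ i → ∣ predecessors i ∣ ℕ.< n
  rank<n i = subst (∣ predecessors i ∣ ℕ.<_) (∣⊤∣≡n n)
    (p⊂q⇒∣p∣<∣q∣ ((λ _ → ∈⊤) , i , ∈⊤ , i∉predecessors i))

  rank : Fin n → Fin n
  rank i = fromℕ< (rank<n i)

  ≺⇒rank< : ∀ {i j} → i ≺ j → rank i < rank j
  ≺⇒rank< {i} {j} i≺j rewrite Fin.toℕ-fromℕ< (rank<n i) | Fin.toℕ-fromℕ< (rank<n j) = rank-mono i≺j

  rank<⇒≺ : ∀ {i j} → rank i < rank j → i ≺ j
  rank<⇒≺ {i} {j} r with O.compare i j
  ... | tri< i≺j _ _    = i≺j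
  ... | tri≈ _ refl _   = contradiction r (ℕ.<-irrefl refl)
  ... | tri> _ _ j≺i    = contradiction r (ℕ.<-asym (≺⇒rank< j≺i))

  rank-injective : Injective _≡_ _≡_ rank
  rank-injective {i} {j} eq with O.compare i j
  ... | tri< i≺j _ _  = contradiction (cong toℕ eq) (ℕ.<⇒≢ (≺⇒rank< i≺j))
  ... | tri≈ _ i≡j _  = i≡j
  ... | tri> _ _ j≺i  = contradiction (cong toℕ (sym eq)) (ℕ.<⇒≢ (≺⇒rank< j≺i))

  permutation : Permutation′ n
  permutation = injective⇒permutation rank rank-injective

-- Inversion sets

Inv : Permutation′ n → Rel (Fin n) 0ℓ
Inv w i j = inv w (i , j)

Inv? : (w : Permutation′ n) → B.Decidable (Inv w)
Inv? w i j = i <? j ×-dec (w ⟨$⟩ʳ j) <? (w ⟨$⟩ʳ i)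

NonInv : Permutation′ n → Rel (Fin n) 0ℓ
NonInv w i j = i < j × (w ⟨$⟩ʳ i) < (w ⟨$⟩ʳ j)

NonInv? : (w : Permutation′ n) → B.Decidable (NonInv w)
NonInv? w i j = i <? j ×-dec (w ⟨$⟩ʳ i) <? (w ⟨$⟩ʳ j)

Cotransitive : Rel (Fin n) 0ℓ → Set
Cotransitive C = ∀ {i j k} → i < j → j < k → C i k → C i j ⊎ C j k

record Biclosed (C : Rel (Fin n) 0ℓ) : Set where
  field
    increasing   : C ⇒ _<_
    decidable    : B.Decidable C
    transitive   : Transitive C
    cotransitive : Cotransitive C

⟨$⟩ʳ-injective : (w : Permutation′ n) → Injective _≡_ _≡_ (w ⟨$⟩ʳ_)
⟨$⟩ʳ-injective w eq = trans (sym (Perm.inverseˡ w)) (trans (cong (w ⟨$⟩ˡ_) eq) (Perm.inverseˡ w))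

≮⇒> : (w : Permutation′ n) {i j : Fin n} → i ≢ j → ¬ (w ⟨$⟩ʳ i) < (w ⟨$⟩ʳ j) → (w ⟨$⟩ʳ j) < (w ⟨$⟩ʳ i)
≮⇒> w i≢j ≮ = Fin.≤∧≢⇒< (ℕ.≮⇒≥ ≮) (i≢j ∘ sym ∘ ⟨$⟩ʳ-injective w)

¬Inv⇒NonInv : (w : Permutation′ n) {i j : Fin n} → i < j → ¬ Inv w i j → NonInv w i j
¬Inv⇒NonInv w i<j ¬p = i<j , ≮⇒> w (<⇒≢ i<j ∘ sym) (λ q → ¬p (i<j , q))

module _ {C : Rel (Fin n) 0ℓ} (C-biclosed : Biclosed C) where
  open Biclosed C-biclosed

  private
    -- The order of the values at the positions that `C` prescribes as an inversion set; ranking the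
    -- positions by it yields the permutation.
    _≺_ : Rel (Fin n) 0ℓ
    i ≺ j = (i < j × ¬ C i j) ⊎ C j i

    -- In the mixed cases the position of `k` relative to `i` decides: for `i < k` transitivity
    -- rules out `C i k`, and for `k < i` cotransitivity yields `C k i`.
    ≺-trans : Transitive _≺_
    ≺-trans (inj₁ (i<j , ¬Cij)) (inj₁ (j<k , ¬Cjk)) =
      inj₁ (ℕ.<-trans i<j j<k , λ Cik → [ ¬Cij , ¬Cjk ]′ (cotransitive i<j j<k Cik))
    ≺-trans {i} {j} {k} (inj₁ (i<j , ¬Cij)) (inj₂ Ckj) with <-cmp i k
    ... | tri< i<k _ _  = inj₁ (i<k , λ Cik → ¬Cij (transitive Cik Ckj))
    ... | tri≈ _ refl _ = contradiction Ckj ¬Cij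
    ... | tri> _ _ k<i  = [ inj₂ , flip contradiction ¬Cij ]′ (cotransitive k<i i<j Ckj)
    ≺-trans {i} {j} {k} (inj₂ Cji) (inj₁ (j<k , ¬Cjk)) with <-cmp i k
    ... | tri< i<k _ _  = inj₁ (i<k , λ Cik → ¬Cjk (transitive Cji Cik))
    ... | tri≈ _ refl _ = contradiction Cji ¬Cjk
    ... | tri> _ _ k<i  = [ flip contradiction ¬Cjk , inj₂ ]′ (cotransitive j<k k<i Cji)
    ≺-trans (inj₂ Cji) (inj₂ Ckj) = inj₂ (transitive Ckj Cji)

    ≺-irrefl : ∀ {i} → ¬ i ≺ i
    ≺-irrefl (inj₁ (i<i , _)) = ℕ.<-irrefl refl i<i
    ≺-irrefl (inj₂ Cii)       = ℕ.<-irrefl refl (increasing Cii)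

    ≺-total : ∀ {i j} → i < j → i ≺ j ⊎ j ≺ i
    ≺-total {i} {j} i<j with decidable i j
    ... | yes Cij = inj₂ (inj₂ Cij)
    ... | no ¬Cij = inj₁ (inj₁ (i<j , ¬Cij))

    ≺-compare : B.Trichotomous _≡_ _≺_
    ≺-compare i j with <-cmp i j
    ... | tri≈ _ refl _ = tri≈ ≺-irrefl refl ≺-irrefl
    ... | tri< i<j i≢j _ = [ (λ p → tri< p i≢j (≺-irrefl ∘ ≺-trans p))
                           , (λ p → tri> (≺-irrefl ∘ ≺-trans p) i≢j p) ]′ (≺-total i<j)
    ... | tri> _ i≢j j<i = [ (λ p → tri> (≺-irrefl ∘ ≺-trans p) i≢j p)
                           , (λ p → tri< p i≢j (≺-irrefl ∘ ≺-trans p)) ]′ (≺-total j<i)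

    ≺-isStrictTotalOrder : IsStrictTotalOrder _≡_ _≺_
    ≺-isStrictTotalOrder = isStrictTotalOrderᶜ record
      { isEquivalence = isEquivalence ; trans = ≺-trans ; compare = ≺-compare }

    module R = Ranking ≺-isStrictTotalOrder

  fromBiclosed : Permutation′ n
  fromBiclosed = R.permutation

  fromBiclosed⁺ : C ⇒ Inv fromBiclosed
  fromBiclosed⁺ Cij = increasing Cij , R.≺⇒rank< (inj₂ Cij)

  fromBiclosed⁻ : Inv fromBiclosed ⇒ C
  fromBiclosed⁻ (i<j , r) with R.rank<⇒≺ r
  ... | inj₁ (j<i , _) = contradiction i<j (ℕ.<-asym j<i)
  ... | inj₂ Cij       = Cij

Inv-transitive : (w : Permutation′ n) → Transitive (Inv w)
Inv-transitive w (i<j , wj<wi) (j<k , wk<wj) = ℕ.<-trans i<j j<k , ℕ.<-trans wk<wj wj<wi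

Inv-cotransitive : (w : Permutation′ n) → Cotransitive (Inv w)
Inv-cotransitive w {i} {j} i<j j<k (_ , wk<wi) with (w ⟨$⟩ʳ j) <? (w ⟨$⟩ʳ i)
... | yes wj<wi = inj₁ (i<j , wj<wi)
... | no  wj≮wi = inj₂ (j<k , ℕ.<-≤-trans wk<wi (ℕ.≮⇒≥ wj≮wi))

NonInv-cotransitive : (w : Permutation′ n) → Cotransitive (NonInv w)
NonInv-cotransitive w {i} {j} i<j j<k (_ , wi<wk) with (w ⟨$⟩ʳ i) <? (w ⟨$⟩ʳ j)
... | yes wi<wj = inj₁ (i<j , wi<wj)
... | no  wi≮wj = inj₂ (j<k , ℕ.≤-<-trans (ℕ.≮⇒≥ wi≮wj) wi<wk)

strictMono⇒inflationary : (f : Fin n → Fin n) → (∀ {i j} → i < j → f i < f j) → ∀ i → i ≤ f i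
strictMono⇒inflationary {suc _} f f-mono = <-weakInduction (λ i → i ≤ f i) ℕ.z≤n λ i i≤fi →
  subst (ℕ._≤ toℕ (f (suc i))) (cong suc (Fin.toℕ-inject₁ i))
    (ℕ.≤-<-trans i≤fi (f-mono (Fin.≤̄⇒inject₁< ℕ.≤-refl)))

-- If the inversion sets agree, `v` after the inverse of `u` is strictly increasing on values, hence
-- inflationary, so each value of `u` is at most that of `v`. Exchanging the two gives equality.
≤S-antisym : {u v : Permutation′ n} → u ≤S v → v ≤S u → u Perm.≈ v
≤S-antisym {u = u} {v} u≤v v≤u i = Fin.≤-antisym (values-≤ {u} {v} u≤v v≤u i) (values-≤ {v} {u} v≤u u≤v i)
  where
  order : {u v : Permutation′ _} → u ≤S v → v ≤S u →
          ∀ {i j} → (u ⟨$⟩ʳ i) < (u ⟨$⟩ʳ j) → (v ⟨$⟩ʳ i) < (v ⟨$⟩ʳ j)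
  order {v = v} u≤v v≤u {i} {j} ui<uj with <-cmp i j
  ... | tri< i<j _ _  = proj₂ (¬Inv⇒NonInv v i<j (λ p → ℕ.<-asym ui<uj (proj₂ (v≤u p))))
  ... | tri≈ _ refl _ = contradiction ui<uj (ℕ.<-irrefl refl)
  ... | tri> _ _ j<i  = proj₂ (u≤v (j<i , ui<uj))

  values-≤ : {u v : Permutation′ _} → u ≤S v → v ≤S u → ∀ i → (u ⟨$⟩ʳ i) ≤ (v ⟨$⟩ʳ i)
  values-≤ {u} {v} u≤v v≤u i =
    subst (λ j → (u ⟨$⟩ʳ i) ≤ (v ⟨$⟩ʳ j)) (Perm.inverseˡ u)
      (strictMono⇒inflationary (λ a → v ⟨$⟩ʳ (u ⟨$⟩ˡ a)) mono (u ⟨$⟩ʳ i))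
    where
    mono : ∀ {a b} → a < b → (v ⟨$⟩ʳ (u ⟨$⟩ˡ a)) < (v ⟨$⟩ʳ (u ⟨$⟩ˡ b))
    mono {a} {b} a<b = order {u} {v} u≤v v≤u
      (subst (λ c → c < (u ⟨$⟩ʳ (u ⟨$⟩ˡ b))) (sym (Perm.inverseʳ u)) (subst (a <_) (sym (Perm.inverseʳ u)) a<b))

-- Transitive closures of cotransitive relations

module _ {G : Rel (Fin n) 0ℓ} where

  ⁺-increasing : G ⇒ _<_ → TransClosure G ⇒ _<_
  ⁺-increasing G⇒< [ g ]   = G⇒< g
  ⁺-increasing G⇒< (g ∷ p) = ℕ.<-trans (G⇒< g) (⁺-increasing G⇒< p)

  ⁺-least : {C : Rel (Fin n) 0ℓ} → Transitive C → G ⇒ C → TransClosure G ⇒ C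
  ⁺-least C-trans G⇒C [ g ]   = G⇒C g
  ⁺-least C-trans G⇒C (g ∷ p) = C-trans (G⇒C g) (⁺-least C-trans G⇒C p)

  module _ (G⇒< : G ⇒ _<_) where

    -- Every step moves to a larger position, so the search over first steps is well founded.
    ⁺-decidable : B.Decidable G → B.Decidable (TransClosure G)
    ⁺-decidable G? i k = go i (>-wellFounded i)
      where
      go : ∀ i → Acc (flip _<_) i → Dec (TransClosure G i k)
      go i (acc rec) = map′ [ [_] , (λ (_ , g , p) → g ∷ p) ]′ (λ where
          [ g ]   → inj₁ g
          (g ∷ p) → inj₂ (_ , g , p))
        (G? i k ⊎-dec any? via?)
        where
        via? : ∀ j → Dec (G i j × TransClosure G j k)
        via? j with G? i j
        ... | no ¬g = no (¬g ∘ proj₁)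
        ... | yes g = map′ (g ,_) proj₂ (go j (rec (G⇒< g)))

    -- Either `j` is a stop of the chain, or exactly one step jumps over it and only that step has
    -- to be split.
    ⁺-cotransitive : Cotransitive G → Cotransitive (TransClosure G)
    ⁺-cotransitive G-co i<j j<k [ g ] = Sum.map [_] [_] (G-co i<j j<k g)
    ⁺-cotransitive G-co {j = j} i<j j<k (_∷_ {y = c} g p) with <-cmp j c
    ... | tri< j<c _ _  = Sum.map [_] (_∷ p) (G-co i<j j<c g)
    ... | tri≈ _ refl _ = inj₁ [ g ]
    ... | tri> _ _ c<j  = Sum.map₁ (g ∷_) (⁺-cotransitive G-co c<j j<k p)

    ⁺-biclosed : B.Decidable G → Cotransitive G → Biclosed (TransClosure G)
    ⁺-biclosed G? G-co = record
      { increasing   = ⁺-increasing G⇒<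
      ; decidable    = ⁺-decidable G?
      ; transitive   = _++_
      ; cotransitive = ⁺-cotransitive G-co
      }

-- Complementation within `_<_` exchanges transitivity and cotransitivity.
complement-biclosed : {C : Rel (Fin n) 0ℓ} → Biclosed C → Biclosed (λ i j → i < j × ¬ C i j)
complement-biclosed {C = C} b = record
  { increasing   = proj₁
  ; decidable    = λ i j → i <? j ×-dec ¬? (decidable i j)
  ; transitive   = λ (i<j , ¬Cij) (j<k , ¬Cjk) →
      ℕ.<-trans i<j j<k , λ Cik → [ ¬Cij , ¬Cjk ]′ (cotransitive i<j j<k Cik)
  ; cotransitive = co
  }
  where
  open Biclosed b
  co : Cotransitive (λ i j → i < j × ¬ C i j)
  co {i} {j} i<j j<k (_ , ¬Cik) with decidable i j
  ... | yes Cij = inj₂ (j<k , λ Cjk → ¬Cik (transitive Cij Cjk))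
  ... | no ¬Cij = inj₁ (i<j , ¬Cij)

_∪ᴿ_ : Rel (Fin n) 0ℓ → Rel (Fin n) 0ℓ → Rel (Fin n) 0ℓ
(C ∪ᴿ D) i j = C i j ⊎ D i j

∪ᴿ-cotransitive : {C D : Rel (Fin n) 0ℓ} → Cotransitive C → Cotransitive D → Cotransitive (C ∪ᴿ D)
∪ᴿ-cotransitive C-co D-co i<j j<k =
  [ Sum.map inj₁ inj₁ ∘ C-co i<j j<k , Sum.map inj₂ inj₂ ∘ D-co i<j j<k ]′

-- The weak order

private
  join-biclosed : (x z : Permutation′ n) → Biclosed (TransClosure (Inv x ∪ᴿ Inv z))
  join-biclosed x z = ⁺-biclosed [ proj₁ , proj₁ ]′ (λ i j → Inv? x i j ⊎-dec Inv? z i j)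
    (∪ᴿ-cotransitive (Inv-cotransitive x) (Inv-cotransitive z))

  meet-biclosed : (x z : Permutation′ n) →
                  Biclosed (λ i j → i < j × ¬ TransClosure (NonInv x ∪ᴿ NonInv z) i j)
  meet-biclosed x z = complement-biclosed
    (⁺-biclosed [ proj₁ , proj₁ ]′ (λ i j → NonInv? x i j ⊎-dec NonInv? z i j)
      (∪ᴿ-cotransitive (NonInv-cotransitive x) (NonInv-cotransitive z)))

infixr 6 _⊔_
infixr 7 _⊓_

abstract

  _⊔_ : Permutation′ n → Permutation′ n → Permutation′ n
  x ⊔ z = fromBiclosed (join-biclosed x z)

  _⊓_ : Permutation′ n → Permutation′ n → Permutation′ n
  x ⊓ z = fromBiclosed (meet-biclosed x z)

  Inv-⊔⁻ : (x z : Permutation′ n) → Inv (x ⊔ z) ⇒ TransClosure (Inv x ∪ᴿ Inv z)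
  Inv-⊔⁻ x z = fromBiclosed⁻ (join-biclosed x z)

  Inv-⊔⁺ : (x z : Permutation′ n) → TransClosure (Inv x ∪ᴿ Inv z) ⇒ Inv (x ⊔ z)
  Inv-⊔⁺ x z = fromBiclosed⁺ (join-biclosed x z)

  Inv-⊓⁻ : (x z : Permutation′ n) → ∀ {i j} → Inv (x ⊓ z) i j →
           i < j × ¬ TransClosure (NonInv x ∪ᴿ NonInv z) i j
  Inv-⊓⁻ x z = fromBiclosed⁻ (meet-biclosed x z)

  Inv-⊓⁺ : (x z : Permutation′ n) → ∀ {i j} →
           i < j × ¬ TransClosure (NonInv x ∪ᴿ NonInv z) i j → Inv (x ⊓ z) i j
  Inv-⊓⁺ x z = fromBiclosed⁺ (meet-biclosed x z)

module _ (x z : Permutation′ n) where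

  x≤x⊔z : Inv x ⇒ Inv (x ⊔ z)
  x≤x⊔z p = Inv-⊔⁺ x z [ inj₁ p ]

  z≤x⊔z : Inv z ⇒ Inv (x ⊔ z)
  z≤x⊔z p = Inv-⊔⁺ x z [ inj₂ p ]

  ⊔-least : ∀ {y} → Inv x ⇒ Inv y → Inv z ⇒ Inv y → Inv (x ⊔ z) ⇒ Inv y
  ⊔-least {y} x≤y z≤y = ⁺-least (Inv-transitive y) [ x≤y , z≤y ]′ ∘ Inv-⊔⁻ x z

  x⊓z≤x : Inv (x ⊓ z) ⇒ Inv x
  x⊓z≤x {i} {j} p with Inv? x i j | Inv-⊓⁻ x z p
  ... | yes q | _              = q
  ... | no ¬q | i<j , ¬nonInv = contradiction [ inj₁ (¬Inv⇒NonInv x i<j ¬q) ] ¬nonInv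

  x⊓z≤z : Inv (x ⊓ z) ⇒ Inv z
  x⊓z≤z {i} {j} p with Inv? z i j | Inv-⊓⁻ x z p
  ... | yes q | _              = q
  ... | no ¬q | i<j , ¬nonInv = contradiction [ inj₂ (¬Inv⇒NonInv z i<j ¬q) ] ¬nonInv

  -- C need not be transitive, so this applies to inversion sets of arcs directly.
  ⊓-greatest : {C : Rel (Fin n) 0ℓ} → Cotransitive C → C ⇒ Inv x → C ⇒ Inv z → C ⇒ Inv (x ⊓ z)
  ⊓-greatest {C} C-co C⇒x C⇒z Cij = Inv-⊓⁺ x z (proj₁ (C⇒x Cij) , separated Cij)
    where
    ¬step : ∀ {i j} → C i j → ¬ (NonInv x ∪ᴿ NonInv z) i j
    ¬step Cij (inj₁ (_ , xi<xj)) = ℕ.<-asym xi<xj (proj₂ (C⇒x Cij))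
    ¬step Cij (inj₂ (_ , zi<zj)) = ℕ.<-asym zi<zj (proj₂ (C⇒z Cij))

    separated : ∀ {i j} → C i j → ¬ TransClosure (NonInv x ∪ᴿ NonInv z) i j
    separated Cij [ s ]   = ¬step Cij s
    -- Splitting at the first stop leaves one of the two parts in `C`; `¬step` excludes the first
    -- step and recursion excludes the rest.
    separated Cij (s ∷ p) =
      [ flip ¬step s , flip separated p ]′
        (C-co ([ proj₁ , proj₁ ]′ s) (⁺-increasing [ proj₁ , proj₁ ]′ p) Cij)

-- Arcs

-- All that is kept of the regions is `N i j k`, to be read as "`j` lies in a region other than
-- those of `i` and `k`", which persists when the outer positions move apart.
module Arcs {N : Fin n → Fin n → Fin n → Set}
  (N? : ∀ i j k → Dec (N i j k))
  (N-widen : ∀ {i i′} j {k k′} → i ≤ i′ → k′ ≤ k → N i′ j k′ → N i j k)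
  where

  -- An arc i < k with a set R stands for the join-irreducible permutation that
  -- takes the values at positions before k and outside R (and at k) below those
  -- at i and at positions after i in R; ArcInv is its inversion set.

  Up : Subset n → Fin n → Pred (Fin n) 0ℓ
  Up R i p = p ≡ i ⊎ (i < p × p ∈ R)

  Down : Subset n → Fin n → Pred (Fin n) 0ℓ
  Down R k q = q ≡ k ⊎ (q < k × q ∉ R)

  ArcInv : Subset n → Fin n → Fin n → Rel (Fin n) 0ℓ
  ArcInv R i k p q = Up R i p × Down R k q × p < q

  Uncontracted : Subset n → Rel (Fin n) 0ℓ
  Uncontracted R i k = ∀ j → i < j → j < k → j ∈ R → ¬ N i j k

  ArcBelow : Permutation′ n → Rel (Fin n) 0ℓ
  ArcBelow x i k = i < k × (∃[ R ] Uncontracted R i k × (∀ p q → ArcInv R i k p q → Inv x p q))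

  Up? : ∀ R i → Decidable (Up R i)
  Up? R i p = p ≟ i ⊎-dec (i <? p ×-dec p ∈? R)

  Down? : ∀ R k → Decidable (Down R k)
  Down? R k q = q ≟ k ⊎-dec (q <? k ×-dec ¬? (q ∈? R))

  ArcBelow? : ∀ x → B.Decidable (ArcBelow x)
  ArcBelow? x i k = i <? k ×-dec anySubset? λ R →
    (all? λ j → i <? j →-dec j <? k →-dec j ∈? R →-dec ¬? (N? i j k)) ×-dec
    (all? λ p → all? λ q → (Up? R i p ×-dec Down? R k q ×-dec p <? q) →-dec Inv? x p q)

  module _ {R : Subset n} where

    Up⇒≥ : ∀ {i p} → Up R i p → i ≤ p
    Up⇒≥ (inj₁ refl)      = ℕ.≤-refl
    Up⇒≥ (inj₂ (i<p , _)) = ℕ.<⇒≤ i<p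

    Down⇒≤ : ∀ {k q} → Down R k q → q ≤ k
    Down⇒≤ (inj₁ refl)      = ℕ.≤-refl
    Down⇒≤ (inj₂ (q<k , _)) = ℕ.<⇒≤ q<k

    Up-trans : ∀ {i p a} → Up R i p → Up R p a → Up R i a
    Up-trans i↑p (inj₁ refl)        = i↑p
    Up-trans i↑p (inj₂ (p<a , a∈R)) = inj₂ (ℕ.≤-<-trans (Up⇒≥ i↑p) p<a , a∈R)

    Down-trans : ∀ {k q b} → Down R k q → Down R q b → Down R k b
    Down-trans k↓q (inj₁ refl)        = k↓q
    Down-trans k↓q (inj₂ (b<q , b∉R)) = inj₂ (ℕ.<-≤-trans b<q (Down⇒≤ k↓q) , b∉R)

    -- A position in between is an Up point if it lies in `R` and a Down point otherwise, so it is
    -- inverted with one of the two ends.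
    ArcInv-cotransitive : ∀ {i k} → Cotransitive (ArcInv R i k)
    ArcInv-cotransitive {j = c} p<c c<q (i↑p , k↓q , _) with c ∈? R
    ... | yes c∈R = inj₂ (inj₂ (ℕ.≤-<-trans (Up⇒≥ i↑p) p<c , c∈R) , k↓q , c<q)
    ... | no  c∉R = inj₁ (i↑p , inj₂ (ℕ.<-≤-trans c<q (Down⇒≤ k↓q) , c∉R) , p<c)

    Uncontracted-narrow : ∀ {i k p q} → i ≤ p → q ≤ k → Uncontracted R i k → Uncontracted R p q
    Uncontracted-narrow i≤p q≤k unc j p<j j<q j∈R Npjq =
      unc j (ℕ.≤-<-trans i≤p p<j) (ℕ.<-≤-trans j<q q≤k) j∈R (N-widen j i≤p q≤k Npjq)

    -- Each inversion of an arc is the pair of ends of an arc with the same `R`, whose inversions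
    -- are among those of the given arc.
    subarc : ∀ {x i k} → Uncontracted R i k → (∀ p q → ArcInv R i k p q → Inv x p q) →
             ArcInv R i k ⇒ ArcBelow x
    subarc unc below (i↑p , k↓q , p<q) =
      p<q , R , Uncontracted-narrow (Up⇒≥ i↑p) (Down⇒≤ k↓q) unc ,
      λ a b (p↑a , q↓b , a<b) → below a b (Up-trans i↑p p↑a , Down-trans k↓q q↓b , a<b)

  ArcBelow⇒Inv : ∀ {x} → ArcBelow x ⇒ Inv x
  ArcBelow⇒Inv (i<k , R , unc , below) = below _ _ (inj₁ refl , inj₁ refl , i<k)

  ArcBelow-cotransitive : ∀ {x} → Cotransitive (ArcBelow x)
  ArcBelow-cotransitive {x} i<j j<k (i<k , R , unc , below) =
    Sum.map (subarc {x = x} unc below) (subarc {x = x} unc below)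
      (ArcInv-cotransitive i<j j<k (inj₁ refl , inj₁ refl , i<k))

  -- The preorder by uncontracted arcs

  infix 4 _⊑_

  -- Only the ends of each arc are tested in `y`. As every inversion of an arc below `x` is again
  -- the pair of ends of such an arc, this already puts the whole arc below `y`; see `⊑-arc`.
  _⊑_ : Rel (Permutation′ n) 0ℓ
  x ⊑ y = ∀ {i k} → ArcBelow x i k → Inv y i k

  ⊑-arc : ∀ {x y} → x ⊑ y → ArcBelow x ⇒ ArcBelow y
  ⊑-arc {x} x⊑y (i<k , R , unc , below) =
    i<k , R , unc , λ p q pq → x⊑y (subarc {x = x} unc below pq)

  ⊑-trans : ∀ {x y z} → x ⊑ y → y ⊑ z → x ⊑ z
  ⊑-trans {x} {y} x⊑y y⊑z = y⊑z ∘ ⊑-arc {x} {y} x⊑y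

  ≤⇒⊑ : ∀ {x y} → Inv x ⇒ Inv y → x ⊑ y
  ≤⇒⊑ {x} x≤y = x≤y ∘ ArcBelow⇒Inv {x}

  -- An arc below the meet lies below `x` and `z`, so its inversions pass to `x′` and `z′`. They
  -- form a cotransitive relation, which suffices for lying below the new meet.
  ⊓-mono-⊑ : ∀ {x x′ z z′} → x ⊑ x′ → z ⊑ z′ → x ⊓ z ⊑ x′ ⊓ z′
  ⊓-mono-⊑ {x} {x′} {z} {z′} x⊑x′ z⊑z′ (i<k , R , unc , below) =
    ⊓-greatest x′ z′ ArcInv-cotransitive
      (x⊑x′ ∘ subarc {x = x} unc (λ p q → x⊓z≤x x z ∘ below p q))
      (z⊑z′ ∘ subarc {x = z} unc (λ p q → x⊓z≤z x z ∘ below p q))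
      (inj₁ refl , inj₁ refl , i<k)

  -- View y as a set of points (position, value).  A good point has no Up point
  -- to its south-west and no Down point to its north-east.  A descending chain
  -- of good points from i to k that cannot be refined has the Up points above
  -- and the Down points below each of its steps, so a step that is an inversion
  -- of some w ≤ y is an uncontracted arc below w.

  module Chain (y : Permutation′ n) {R : Subset n} {i k : Fin n}
    (unc : Uncontracted R i k) (below : ∀ p q → ArcInv R i k p q → Inv y p q)
    where

    Good : Pred (Fin n) 0ℓ
    Good c = (∀ r → Up R i r → r < c → (y ⟨$⟩ʳ c) < (y ⟨$⟩ʳ r))
           × (∀ l → Down R k l → c < l → (y ⟨$⟩ʳ l) < (y ⟨$⟩ʳ c))

    Good? : Decidable Good
    Good? c = (all? λ r → Up? R i r →-dec r <? c →-dec (y ⟨$⟩ʳ c) <? (y ⟨$⟩ʳ r))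
        ×-dec (all? λ l → Down? R k l →-dec c <? l →-dec (y ⟨$⟩ʳ l) <? (y ⟨$⟩ʳ c))

    Up⇒Good : ∀ {c} → (∀ r → Up R i r → r < c → (y ⟨$⟩ʳ c) < (y ⟨$⟩ʳ r)) → Up R i c → Good c
    Up⇒Good above i↑c = above , λ l k↓l c<l → proj₂ (below _ l (i↑c , k↓l , c<l))

    Down⇒Good : ∀ {c} → (∀ l → Down R k l → c < l → (y ⟨$⟩ʳ l) < (y ⟨$⟩ʳ c)) → Down R k c → Good c
    Down⇒Good under k↓c = (λ r i↑r r<c → proj₂ (below r _ (i↑r , k↓c , r<c))) , under

    good-i : Good i
    good-i = Up⇒Good (λ r i↑r r<i → contradiction r<i (ℕ.≤⇒≯ (Up⇒≥ i↑r))) (inj₁ refl)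

    good-k : Good k
    good-k = Down⇒Good (λ l k↓l k<l → contradiction k<l (ℕ.≤⇒≯ (Down⇒≤ k↓l))) (inj₁ refl)

    module _ {p q : Fin n} where

      Between : Pred (Fin n) 0ℓ
      Between c = (p < c × c < q) × ((y ⟨$⟩ʳ q) < (y ⟨$⟩ʳ c) × (y ⟨$⟩ʳ c) < (y ⟨$⟩ʳ p))

      Between? : Decidable Between
      Between? c = (p <? c ×-dec c <? q)
        ×-dec ((y ⟨$⟩ʳ q) <? (y ⟨$⟩ʳ c) ×-dec (y ⟨$⟩ʳ c) <? (y ⟨$⟩ʳ p))

      module Unrefinable (good-p : Good p) (good-q : Good q)
        (unrefinable : ∀ {c} → Between c → ¬ Good c) where

        -- Goodness of `q` puts `r` above `q` in value, and goodness of `p` keeps `r` from lying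
        -- left of `p`. So an Up point that spoils the goodness of `c` stays in the same box.
        southwest-between : ∀ {c r} → Between c → Up R i r → r < c →
                            ¬ (y ⟨$⟩ʳ c) < (y ⟨$⟩ʳ r) → Between r
        southwest-between {c} {r} ((p<c , c<q) , yq<yc , yc<yp) i↑r r<c yc≮yr =
          (p<r , r<q) , proj₁ good-q r i↑r r<q , yr<yp
          where
          r<q = ℕ.<-trans r<c c<q
          yr<yp = ℕ.≤-<-trans (ℕ.≮⇒≥ yc≮yr) yc<yp
          p<r : p < r
          p<r with <-cmp p r
          ... | tri< p<r _ _  = p<r
          ... | tri≈ _ refl _ = contradiction yr<yp (ℕ.<-irrefl refl)
          ... | tri> _ _ r<p  = contradiction yr<yp (ℕ.<-asym (proj₁ good-p r i↑r r<p))

        northeast-between : ∀ {c l} → Between c → Down R k l → c < l →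
                            ¬ (y ⟨$⟩ʳ l) < (y ⟨$⟩ʳ c) → Between l
        northeast-between {c} {l} ((p<c , c<q) , yq<yc , yc<yp) k↓l c<l yl≮yc =
          (p<l , l<q) , yq<yl , proj₂ good-p l k↓l p<l
          where
          p<l = ℕ.<-trans p<c c<l
          yq<yl = ℕ.<-≤-trans yq<yc (ℕ.≮⇒≥ yl≮yc)
          l<q : l < q
          l<q with <-cmp l q
          ... | tri< l<q _ _  = l<q
          ... | tri≈ _ refl _ = contradiction yq<yl (ℕ.<-irrefl refl)
          ... | tri> _ _ q<l  = contradiction yq<yl (ℕ.<-asym (proj₂ good-q l k↓l q<l))

        -- The leftmost Up point in the box would be good, contradicting `unrefinable`.
        ¬Up-between : ∀ {c} → Up R i c → ¬ Between c
        ¬Up-between {c} = go c (<-wellFounded c)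
          where
          go : ∀ c → Acc _<_ c → Up R i c → ¬ Between c
          go c (acc rec) i↑c c-btw = unrefinable c-btw (Up⇒Good above i↑c)
            where
            above : ∀ r → Up R i r → r < c → (y ⟨$⟩ʳ c) < (y ⟨$⟩ʳ r)
            above r i↑r r<c with (y ⟨$⟩ʳ c) <? (y ⟨$⟩ʳ r)
            ... | yes yc<yr = yc<yr
            ... | no  yc≮yr = contradiction (southwest-between c-btw i↑r r<c yc≮yr) (go r (rec r<c) i↑r)

        ¬Down-between : ∀ {c} → Down R k c → ¬ Between c
        ¬Down-between {c} = go c (>-wellFounded c)
          where
          go : ∀ c → Acc (flip _<_) c → Down R k c → ¬ Between c
          go c (acc rec) k↓c c-btw = unrefinable c-btw (Down⇒Good under k↓c)
            where
            under : ∀ l → Down R k l → c < l → (y ⟨$⟩ʳ l) < (y ⟨$⟩ʳ c)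
            under l k↓l c<l with (y ⟨$⟩ʳ l) <? (y ⟨$⟩ʳ c)
            ... | yes yl<yc = yl<yc
            ... | no  yl≮yc = contradiction (northeast-between c-btw k↓l c<l yl≮yc) (go l (rec c<l) k↓l)

        module _ (i≤p : i ≤ p) (q≤k : q ≤ k) where

          ¬between : ∀ {c} → ¬ Between c
          ¬between {c} c-btw@((p<c , c<q) , _) with c ∈? R
          ... | yes c∈R = ¬Up-between (inj₂ (ℕ.≤-<-trans i≤p p<c , c∈R)) c-btw
          ... | no  c∉R = ¬Down-between (inj₂ (ℕ.<-≤-trans c<q q≤k , c∉R)) c-btw

          -- If an Up point `a` had a smaller value than `p` in `w`, that inversion would also be
          -- one of `y` and place `a` in the empty box; dually for Down points and `q`. Hence `w`
          -- inverts all pairs of the arc from `p` to `q`.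
          step : ∀ {w} → Inv w ⇒ Inv y → Inv w p q → ArcBelow w p q
          step {w} w≤y (p<q , wq<wp) =
            p<q , R , Uncontracted-narrow i≤p q≤k unc , λ a b (p↑a , q↓b , a<b) →
              a<b , ℕ.≤-<-trans (w-Down q↓b (ℕ.≤-<-trans (Up⇒≥ p↑a) a<b))
                      (ℕ.<-≤-trans wq<wp (w-Up p↑a (ℕ.<-≤-trans a<b (Down⇒≤ q↓b))))
            where
            w-Up : ∀ {a} → Up R p a → a < q → (w ⟨$⟩ʳ p) ≤ (w ⟨$⟩ʳ a)
            w-Up (inj₁ refl) _ = ℕ.≤-refl
            w-Up {a} (inj₂ (p<a , a∈R)) a<q = ℕ.≮⇒≥ λ wa<wp →
              ¬between ((p<a , a<q) ,
                proj₁ good-q a (inj₂ (ℕ.≤-<-trans i≤p p<a , a∈R)) a<q , proj₂ (w≤y (p<a , wa<wp)))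

            w-Down : ∀ {b} → Down R q b → p < b → (w ⟨$⟩ʳ b) ≤ (w ⟨$⟩ʳ q)
            w-Down (inj₁ refl) _ = ℕ.≤-refl
            w-Down {b} (inj₂ (b<q , b∉R)) p<b = ℕ.≮⇒≥ λ wq<wb →
              ¬between ((p<b , b<q) ,
                proj₂ (w≤y (b<q , wq<wb)) , proj₂ good-p b (inj₂ (ℕ.<-≤-trans b<q q≤k , b∉R)) p<b)

  -- The inversion from `i` to `k` is refined through good points as far as possible. A step that
  -- needed several inversions of `x` and `z` would have a stop in its empty box. So each step is
  -- one inversion of `x` or of `z`, hence an uncontracted arc, and passes to `x′` or `z′`.
  ⊔-mono-⊑ : ∀ {x x′ z z′} → x ⊑ x′ → z ⊑ z′ → x ⊔ z ⊑ x′ ⊔ z′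
  ⊔-mono-⊑ {x} {x′} {z} {z′} x⊑x′ z⊑z′ {i} {k} (i<k , R , unc , below) =
    go ℕ.≤-refl ℕ.≤-refl good-i good-k (below i k (inj₁ refl , inj₁ refl , i<k)) (ℕ.<-wellFounded _)
    where
    open Chain (x ⊔ z) unc below

    go : ∀ {p q} → i ≤ p → q ≤ k → Good p → Good q → Inv (x ⊔ z) p q →
         ℕ.Acc ℕ._<_ (toℕ q ℕ.∸ toℕ p) → Inv (x′ ⊔ z′) p q
    go {p} {q} i≤p q≤k good-p good-q (p<q , yq<yp) (acc rec)
      with any? (λ c → Between? c ×-dec Good? c)
    ... | yes (c , ((p<c , c<q) , yq<yc , yc<yp) , good-c) =
      Inv-transitive (x′ ⊔ z′)
        (go i≤p (ℕ.≤-trans (ℕ.<⇒≤ c<q) q≤k) good-p good-c (p<c , yc<yp) (rec (ℕ.∸-monoˡ-< c<q (ℕ.<⇒≤ p<c))))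
        (go (ℕ.≤-trans i≤p (ℕ.<⇒≤ p<c)) q≤k good-c good-q (c<q , yq<yc) (rec (ℕ.∸-monoʳ-< p<c (ℕ.<⇒≤ c<q))))
    ... | no unrefinable = single (Inv-⊔⁻ x z (p<q , yq<yp))
      where
      open Unrefinable good-p good-q (λ c-btw good-c → unrefinable (_ , c-btw , good-c))

      single : TransClosure (Inv x ∪ᴿ Inv z) p q → Inv (x′ ⊔ z′) p q
      single [ inj₁ s ] = x≤x⊔z x′ z′ (x⊑x′ (step i≤p q≤k {x} (x≤x⊔z x z) s))
      single [ inj₂ s ] = z≤x⊔z x′ z′ (z⊑z′ (step i≤p q≤k {z} (z≤x⊔z x z) s))
      single (s ∷ t) with Inv-⊔⁺ x z [ s ] | Inv-⊔⁺ x z t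
      ... | p<c , yc<yp | c<q , yq<yc = contradiction ((p<c , c<q) , yq<yc , yc<yp) (¬between i≤p q≤k)

  -- Avoiding permutations as least elements of their classes

  Avoids : Pred (Permutation′ n) 0ℓ
  Avoids x = ∀ {i j k} → i < j → j < k → N i j k → (x ⟨$⟩ʳ i) < (x ⟨$⟩ʳ j) →
             toℕ (x ⟨$⟩ʳ i) ≢ suc (toℕ (x ⟨$⟩ʳ k))

  module _ (x : Permutation′ n) where

    private
      π-biclosed : Biclosed (TransClosure (ArcBelow x))
      π-biclosed = ⁺-biclosed proj₁ (ArcBelow? x) (ArcBelow-cotransitive {x})

    abstract

      -- The greatest avoiding permutation below x.
      π : Permutation′ n
      π = fromBiclosed π-biclosed

      Inv-π⁻ : Inv π ⇒ TransClosure (ArcBelow x)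
      Inv-π⁻ = fromBiclosed⁻ π-biclosed

      Inv-π⁺ : TransClosure (ArcBelow x) ⇒ Inv π
      Inv-π⁺ = fromBiclosed⁺ π-biclosed

    π≤ : Inv π ⇒ Inv x
    π≤ = ⁺-least (Inv-transitive x) (ArcBelow⇒Inv {x}) ∘ Inv-π⁻

    ⊑π : x ⊑ π
    ⊑π b = Inv-π⁺ [ b ]

    -- The values at `i` and `k` are consecutive, so no chain of arcs can stop between them and the
    -- inversion is a single arc. If `j` is in `R`, that arc is contracted; otherwise it makes
    -- `(i , j)` an inversion of `π`.
    π-avoids : Avoids π
    π-avoids {i} {j} {k} i<j j<k Nijk πi<πj πi≡1+πk =
      absurd (Inv-π⁻ (ℕ.<-trans i<j j<k , ℕ.≤-reflexive (sym πi≡1+πk)))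
      where
      absurd : ¬ TransClosure (ArcBelow x) i k
      absurd [ i<k , R , unc , below ] with j ∈? R
      ... | yes j∈R = unc j i<j j<k j∈R Nijk
      ... | no  j∉R = ℕ.<-asym πi<πj
        (proj₂ (⊑π (subarc {x = x} unc below (inj₁ refl , inj₂ (j<k , j∉R) , i<j))))
      absurd (b ∷ p) = ℕ.<⇒≱ (proj₂ (⊑π b))
        (ℕ.≤-trans (ℕ.≤-reflexive πi≡1+πk) (proj₂ (Inv-π⁺ p)))

  module _ {x : Permutation′ n} (avoids : Avoids x) {y : Permutation′ n} (x⊑y : x ⊑ y) where

    -- Take the arc from `c` to `d` whose `R` collects the positions with values above that of `c`.
    -- Avoidance makes it uncontracted, its inversions are inversions of `x`, and `(p , q)` is one
    -- of them.
    descent : ∀ {c d} → c < d → toℕ (x ⟨$⟩ʳ c) ≡ suc (toℕ (x ⟨$⟩ʳ d)) →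
              ∀ {p q} → c ≤ p → p < q → q ≤ d → (x ⟨$⟩ʳ c) ≤ (x ⟨$⟩ʳ p) → (x ⟨$⟩ʳ q) ≤ (x ⟨$⟩ʳ d) →
              Inv y p q
    descent {c} {d} c<d xc≡1+xd {p} {q} c≤p p<q q≤d xc≤xp xq≤xd =
      x⊑y (subarc {x = x} unc below (c↑p , d↓q , p<q))
      where
      higher? : Decidable (λ r → (x ⟨$⟩ʳ c) < (x ⟨$⟩ʳ r))
      higher? r = (x ⟨$⟩ʳ c) <? (x ⟨$⟩ʳ r)

      R : Subset n
      R = comprehension higher?

      xd<xc : (x ⟨$⟩ʳ d) < (x ⟨$⟩ʳ c)
      xd<xc = ℕ.≤-reflexive (sym xc≡1+xd)

      unc : Uncontracted R c d
      unc j c<j j<d j∈R Ncjd = avoids c<j j<d Ncjd (∈-comprehension⁻ higher? j∈R) xc≡1+xd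

      Up⇒high : ∀ {a} → Up R c a → (x ⟨$⟩ʳ c) ≤ (x ⟨$⟩ʳ a)
      Up⇒high (inj₁ refl)      = ℕ.≤-refl
      Up⇒high (inj₂ (_ , a∈R)) = ℕ.<⇒≤ (∈-comprehension⁻ higher? a∈R)

      Down⇒low : ∀ {b} → Down R d b → (x ⟨$⟩ʳ b) ≤ (x ⟨$⟩ʳ c)
      Down⇒low (inj₁ refl)      = ℕ.<⇒≤ xd<xc
      Down⇒low (inj₂ (_ , b∉R)) = ℕ.≮⇒≥ (b∉R ∘ ∈-comprehension⁺ higher?)

      below : ∀ a b → ArcInv R c d a b → Inv x a b
      below a b (c↑a , d↓b , a<b) =
        a<b , Fin.≤∧≢⇒< (ℕ.≤-trans (Down⇒low d↓b) (Up⇒high c↑a)) (<⇒≢ a<b ∘ sym ∘ ⟨$⟩ʳ-injective x)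

      c↑p : Up R c p
      c↑p with p ≟ c
      ... | yes p≡c = inj₁ p≡c
      ... | no  p≢c = inj₂ (Fin.≤∧≢⇒< c≤p (p≢c ∘ sym) ,
        ∈-comprehension⁺ higher? (Fin.≤∧≢⇒< xc≤xp (p≢c ∘ sym ∘ ⟨$⟩ʳ-injective x)))

      d↓q : Down R d q
      d↓q with q ≟ d
      ... | yes q≡d = inj₁ q≡d
      ... | no  q≢d = inj₂ (Fin.≤∧≢⇒< q≤d q≢d ,
        λ q∈R → ℕ.<-asym xd<xc (ℕ.<-≤-trans (∈-comprehension⁻ higher? q∈R) xq≤xd))

    -- Descend through consecutive values from x a, at positions c ≤ a, until the
    -- position jumps over a; that descent puts y a above y at the landing position.
    avoids-⊑⇒≤ : Inv x ⇒ Inv y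
    avoids-⊑⇒≤ {a} {b} (a<b , xb<xa) = go ℕ.≤-refl ℕ.≤-refl a<b xb<xa (<-wellFounded _)
      where
      go : ∀ {a c} → c ≤ a → (x ⟨$⟩ʳ c) ≤ (x ⟨$⟩ʳ a) → a < b → (x ⟨$⟩ʳ b) < (x ⟨$⟩ʳ c) →
           Acc _<_ (x ⟨$⟩ʳ c) → Inv y a b
      go {a} {c} c≤a xc≤xa a<b xb<xc (acc rec) with predecessor xb<xc
        where
        predecessor : ∀ {v u : Fin n} → v < u → ∃[ d ] toℕ u ≡ suc (toℕ (x ⟨$⟩ʳ d))
        predecessor {u = suc u} _ = x ⟨$⟩ˡ inject₁ u ,
          cong suc (trans (sym (Fin.toℕ-inject₁ u)) (cong toℕ (sym (Perm.inverseʳ x))))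
      ... | d , xc≡1+xd = cases (d Fin.≤? a) (d <? b)
        where
        xd<xc : (x ⟨$⟩ʳ d) < (x ⟨$⟩ʳ c)
        xd<xc = ℕ.≤-reflexive (sym xc≡1+xd)

        xb≤xd : (x ⟨$⟩ʳ b) ≤ (x ⟨$⟩ʳ d)
        xb≤xd = ℕ.s≤s⁻¹ (ℕ.≤-trans xb<xc (ℕ.≤-reflexive xc≡1+xd))

        xb<xd : d ≢ b → (x ⟨$⟩ʳ b) < (x ⟨$⟩ʳ d)
        xb<xd d≢b = Fin.≤∧≢⇒< xb≤xd (d≢b ∘ sym ∘ ⟨$⟩ʳ-injective x)

        cases : Dec (d ≤ a) → Dec (d < b) → Inv y a b
        cases (yes d≤a) _ =
          go d≤a (ℕ.≤-trans (ℕ.<⇒≤ xd<xc) xc≤xa) a<b (xb<xd (<⇒≢ (ℕ.≤-<-trans d≤a a<b))) (rec xd<xc)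
        -- The descent lands strictly between `a` and `b`: it inverts `a` with `d`, and the search
        -- restarts from `d`.
        cases (no d≰a) (yes d<b) =
          Inv-transitive y
            (descent (ℕ.≤-<-trans c≤a a<d) xc≡1+xd c≤a a<d ℕ.≤-refl xc≤xa ℕ.≤-refl)
            (go ℕ.≤-refl ℕ.≤-refl d<b (xb<xd (<⇒≢ d<b)) (rec xd<xc))
          where a<d = ℕ.≰⇒> d≰a
        -- The descent lands at or beyond `b`, so `b` is one of its Down points and is inverted with
        -- `a` at once.
        cases (no d≰a) (no d≮b) =
          descent (ℕ.≤-<-trans c≤a (ℕ.≰⇒> d≰a)) xc≡1+xd c≤a a<b (ℕ.≮⇒≥ d≮b) xc≤xa xb≤xd

-- Parabolic quotients

module _ {m} {J : Subset m} where

  InParabolicQuotient-down : ∀ {x y} → Inv x ⇒ Inv y → InParabolicQuotient J y → InParabolicQuotient J x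
  InParabolicQuotient-down {x} x≤y y∈ i i∈J = proj₂ (¬Inv⇒NonInv x (Fin.≤̄⇒inject₁< ℕ.≤-refl)
    (λ p → ℕ.<-asym (y∈ i i∈J) (proj₂ (x≤y p))))

  InParabolicQuotient-⊔ : ∀ {x z} → InParabolicQuotient J x → InParabolicQuotient J z →
                          InParabolicQuotient J (x ⊔ z)
  InParabolicQuotient-⊔ {x} {z} x∈ z∈ i i∈J =
    proj₂ (¬Inv⇒NonInv (x ⊔ z) (Fin.≤̄⇒inject₁< ℕ.≤-refl) (¬descent ∘ Inv-⊔⁻ x z))
    where
    ¬descent : ¬ TransClosure (Inv x ∪ᴿ Inv z) (inject₁ i) (suc i)
    ¬descent [ inj₁ (_ , p) ] = ℕ.<-asym p (x∈ i i∈J)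
    ¬descent [ inj₂ (_ , p) ] = ℕ.<-asym p (z∈ i i∈J)
    -- A longer chain would need a stop strictly between two adjacent positions.
    ¬descent (_∷_ {y = c} s t) = ℕ.<⇒≱ (⁺-increasing [ proj₁ , proj₁ ]′ t)
      (subst (ℕ._< toℕ c) (Fin.toℕ-inject₁ i) ([ proj₁ , proj₁ ]′ s))

weakIsLattice : ∀ {m} (J : Subset m) → WeakIsLattice J
weakIsLattice J = record
  { _∨_ = λ (x , x∈) (z , z∈) → x ⊔ z , InParabolicQuotient-⊔ {x = x} {z} x∈ z∈
  ; _∧_ = λ (x , x∈) (z , z∈) → x ⊓ z , InParabolicQuotient-down {x = x ⊓ z} {x} (x⊓z≤x x z) x∈
  ; isLattice = record
    { isPartialOrder = record
      { isPreorder = record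
        { isEquivalence = record
          { refl  = λ _ → refl
          ; sym   = λ x≈y i → sym (x≈y i)
          ; trans = λ x≈y y≈z i → trans (x≈y i) (y≈z i)
          }
        ; reflexive = λ { x≈y {i , j} (i<j , xj<xi) → i<j , subst₂ _<_ (x≈y j) (x≈y i) xj<xi }
        ; trans     = λ x≤y y≤z → y≤z ∘ x≤y
        }
      ; antisym = λ {(x , _)} {(y , _)} → ≤S-antisym {u = x} {y}
      }
    ; supremum = λ (x , _) (z , _) →
        x≤x⊔z x z , z≤x⊔z x z , λ (y , _) x≤y z≤y → ⊔-least x z {y} x≤y z≤y
    ; infimum  = λ (x , _) (z , _) →
        x⊓z≤x x z , x⊓z≤z x z , λ (y , _) y≤x y≤z → ⊓-greatest x z (Inv-cotransitive y) y≤x y≤z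
    }
  }

-- Regions, the Tamari lattice and the quotient map

region-mono : ∀ {m} (J : Subset m) {i j} → i ≤ j → region J i ℕ.≤ region J j
region-mono J             {zero}          _         = ℕ.z≤n
region-mono (inside  ∷ J) {suc _} {suc _} (ℕ.s≤s p) = region-mono J p
region-mono (outside ∷ J) {suc _} {suc _} (ℕ.s≤s p) = ℕ.s≤s (region-mono J p)

module _ {m} (J : Subset m) where

  -- Regions increase weakly with the position, so for `i < j < k` lying in three different regions
  -- means two strict jumps. The strict form survives moving the outer positions apart.
  Separated : Fin (suc m) → Fin (suc m) → Fin (suc m) → Set
  Separated i j k = region J i ℕ.< region J j × region J j ℕ.< region J k

  Separated? : ∀ i j k → Dec (Separated i j k)
  Separated? i j k = region J i ℕ.<? region J j ×-dec region J j ℕ.<? region J k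

  Separated-widen : ∀ {i i′} j {k k′} → i ≤ i′ → k′ ≤ k → Separated i′ j k′ → Separated i j k
  Separated-widen j i≤i′ k′≤k (p , q) =
    ℕ.≤-<-trans (region-mono J i≤i′) p , ℕ.<-≤-trans q (region-mono J k′≤k)

  open Arcs Separated? Separated-widen

  Avoids⇒Avoids231 : ∀ {w} → Avoids w → ¬ Contains231 J w
  Avoids⇒Avoids231 avoids c = avoids i<j j<k
    ( ℕ.≤∧≢⇒< (region-mono J (ℕ.<⇒≤ i<j)) rᵢ≢rⱼ
    , ℕ.≤∧≢⇒< (region-mono J (ℕ.<⇒≤ j<k)) rⱼ≢rₖ ) wᵢ<wⱼ wᵢ≡wₖ+1
    where
    open Contains231 c

  Avoids231⇒Avoids : ∀ {w} → ¬ Contains231 J w → Avoids w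
  Avoids231⇒Avoids avoids i<j j<k (rᵢ<rⱼ , rⱼ<rₖ) wᵢ<wⱼ wᵢ≡wₖ+1 = avoids record
    { i<j     = i<j
    ; j<k     = j<k
    ; rᵢ≢rⱼ   = ℕ.<⇒≢ rᵢ<rⱼ
    ; rⱼ≢rₖ   = ℕ.<⇒≢ rⱼ<rₖ
    ; rᵢ≢rₖ   = ℕ.<⇒≢ (ℕ.<-trans rᵢ<rⱼ rⱼ<rₖ)
    ; wₖ<wᵢ   = ℕ.≤-reflexive (sym wᵢ≡wₖ+1)
    ; wᵢ<wⱼ   = wᵢ<wⱼ
    ; wᵢ≡wₖ+1 = wᵢ≡wₖ+1
    }

  private
    module W = LatticeOrder (weakIsLattice J)
    module WL = IsLattice W.isLattice
    module T = Tamari J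

    infix 4 _⊑ᵂ_

    _⊑ᵂ_ : Rel (ParabolicQuotient J) 0ℓ
    (x , _) ⊑ᵂ (y , _) = x ⊑ y

    ⊑ᵂ-trans : Transitive _⊑ᵂ_
    ⊑ᵂ-trans {x , _} {y , _} {z , _} = ⊑-trans {x} {y} {z}

    ≤⇒⊑ᵂ : Weak._≤_ J ⇒ _⊑ᵂ_
    ≤⇒⊑ᵂ {x , _} {y , _} x≤y = ≤⇒⊑ {x} {y} x≤y

    ∨-mono : ∀ {x x′ z z′} → x ⊑ᵂ x′ → z ⊑ᵂ z′ → (x W.∨ z) ⊑ᵂ (x′ W.∨ z′)
    ∨-mono {x , _} {x′ , _} {z , _} {z′ , _} = ⊔-mono-⊑ {x} {x′} {z} {z′}

    ∧-mono : ∀ {x x′ z z′} → x ⊑ᵂ x′ → z ⊑ᵂ z′ → (x W.∧ z) ⊑ᵂ (x′ W.∧ z′)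
    ∧-mono {x , _} {x′ , _} {z , _} {z′ , _} = ⊓-mono-⊑ {x} {x′} {z} {z′}

    project : ParabolicQuotient J → ParabolicQuotient231 J
    project (x , x∈) = (π x , InParabolicQuotient-down {x = π x} {x} (π≤ x) x∈) , Avoids⇒Avoids231 (π-avoids x)

    project-⊑ : ∀ x → proj₁ (project x) ⊑ᵂ x
    project-⊑ (x , _) = ≤⇒⊑ {π x} {x} (π≤ x)

    ⊑-project : ∀ x → x ⊑ᵂ proj₁ (project x)
    ⊑-project (x , _) = ⊑π x

    avoiding-⊑⇒≤ : ∀ (x : ParabolicQuotient231 J) y → proj₁ x ⊑ᵂ y → Weak._≤_ J (proj₁ x) y
    avoiding-⊑⇒≤ ((x , _) , avoids) (y , _) x⊑y = avoids-⊑⇒≤ {x} (Avoids231⇒Avoids avoids) {y} x⊑y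

    project-mono : ∀ {x y} → x ⊑ᵂ y → project x T.≤ project y
    project-mono {x} {y} x⊑y = avoiding-⊑⇒≤ (project x) (proj₁ (project y))
      (⊑ᵂ-trans {proj₁ (project x)} {y} {proj₁ (project y)}
        (⊑ᵂ-trans {proj₁ (project x)} {x} {y} (project-⊑ x) x⊑y) (⊑-project y))

  -- Avoiding elements below an element stay below its projection. So the projected meet is the
  -- greatest avoiding lower bound, while the projected join agrees with the weak join up to `_≈_`.
  tamariIsLattice : TamariIsLattice J
  tamariIsLattice = record
    { _∨_ = λ x y → project (proj₁ x W.∨ proj₁ y)
    ; _∧_ = λ x y → project (proj₁ x W.∧ proj₁ y)
    ; isLattice = record
      { isPartialOrder = record
        { isPreorder = record
          { isEquivalence = record
            { refl  = λ _ → refl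
            ; sym   = λ x≈y i → sym (x≈y i)
            ; trans = λ x≈y y≈z i → trans (x≈y i) (y≈z i)
            }
          ; reflexive = λ {x} {y} → WL.reflexive {proj₁ x} {proj₁ y}
          ; trans     = λ x≤y y≤z → y≤z ∘ x≤y
          }
        ; antisym = λ {x} {y} → WL.antisym {proj₁ x} {proj₁ y}
        }
      ; supremum = λ x y →
          ( ≤-project x (proj₁ x W.∨ proj₁ y) (WL.x≤x∨y (proj₁ x) (proj₁ y))
          , ≤-project y (proj₁ x W.∨ proj₁ y) (WL.y≤x∨y (proj₁ x) (proj₁ y))
          , λ z x≤z y≤z → WL.∨-least {proj₁ x} {proj₁ y} {proj₁ z} x≤z y≤z ∘ π≤ (proj₁ (proj₁ x W.∨ proj₁ y)))
      ; infimum  = λ x y →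
          ( WL.x∧y≤x (proj₁ x) (proj₁ y) ∘ π≤ (proj₁ (proj₁ x W.∧ proj₁ y))
          , WL.x∧y≤y (proj₁ x) (proj₁ y) ∘ π≤ (proj₁ (proj₁ x W.∧ proj₁ y))
          , λ z z≤x z≤y → ≤-project z (proj₁ x W.∧ proj₁ y)
              (WL.∧-greatest {proj₁ z} {proj₁ x} {proj₁ y} z≤x z≤y))
      }
    }
    where
    ≤-project : ∀ x y → Weak._≤_ J (proj₁ x) y → x T.≤ project y
    ≤-project x y x≤y = avoiding-⊑⇒≤ x (proj₁ (project y))
      (⊑ᵂ-trans {proj₁ x} {y} {proj₁ (project y)} (≤⇒⊑ᵂ {proj₁ x} {y} x≤y) (⊑-project y))

  -- Each `x` is related to its projection, and related elements have equal projections. Hence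
  -- `project` induces a bijection from classes to avoiding elements, and the homomorphism laws
  -- reduce to monotonicity of the operations for `_⊑ᵂ_`.
  tamariIsLatticeQuotient : IsLatticeQuotientOf tamariIsLattice (weakIsLattice J)
  tamariIsLatticeQuotient = _Θ_ , Θ-isLatticeCongruence , project , record
    { isLatticeMonomorphism = record
      { isLatticeHomomorphism = record
        { isRelHomomorphism = record { cong = λ {x} {y} → project-cong {x} {y} }
        ; ∧-homo = λ x y → project-cong {x W.∧ y} {proj₁ (project x) W.∧ proj₁ (project y)}
            ( ∧-mono {x} {proj₁ (project x)} {y} {proj₁ (project y)} (⊑-project x) (⊑-project y)
            , ∧-mono {proj₁ (project x)} {x} {proj₁ (project y)} {y} (project-⊑ x) (project-⊑ y))
        ; ∨-homo = λ x y → project-cong {x W.∨ y} {proj₁ (project x) W.∨ proj₁ (project y)}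
            ( ∨-mono {x} {proj₁ (project x)} {y} {proj₁ (project y)} (⊑-project x) (⊑-project y)
            , ∨-mono {proj₁ (project x)} {x} {proj₁ (project y)} {y} (project-⊑ x) (project-⊑ y))
        }
      ; injective = λ {x} {y} πx≈πy → Θ-trans {x} {proj₁ (project x)} {y} (Θ-project x)
          (Θ-trans {proj₁ (project x)} {proj₁ (project y)} {y}
            (Θ-reflexive {proj₁ (project x)} {proj₁ (project y)} πx≈πy)
            (Θ-sym {y} {proj₁ (project y)} (Θ-project y)))
      }
    ; surjective = λ y → proj₁ y , λ {x} xΘy i →
        trans (project-cong {x} {proj₁ y} xΘy i) (project-avoiding y i)
    }
    where
    _Θ_ : Rel (ParabolicQuotient J) 0ℓ
    x Θ y = (x ⊑ᵂ y) × (y ⊑ᵂ x)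

    Θ-sym : B.Symmetric _Θ_
    Θ-sym (x⊑y , y⊑x) = y⊑x , x⊑y

    Θ-trans : Transitive _Θ_
    Θ-trans {x} {y} {z} (x⊑y , y⊑x) (y⊑z , z⊑y) =
      ⊑ᵂ-trans {x} {y} {z} x⊑y y⊑z , ⊑ᵂ-trans {z} {y} {x} z⊑y y⊑x

    Θ-reflexive : Weak._≈_ J ⇒ _Θ_
    Θ-reflexive {x} {y} x≈y =
      ≤⇒⊑ᵂ {x} {y} (WL.reflexive {x} {y} x≈y) , ≤⇒⊑ᵂ {y} {x} (WL.reflexive {y} {x} (λ i → sym (x≈y i)))

    ⊑ᵂ-refl : ∀ x → x ⊑ᵂ x
    ⊑ᵂ-refl x = ≤⇒⊑ᵂ {x} {x} (λ p → p)

    Θ-isLatticeCongruence : IsLatticeCongruence W.lattice _Θ_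
    Θ-isLatticeCongruence = record
      { isEquivalence = record
        { refl  = λ {x} → ⊑ᵂ-refl x , ⊑ᵂ-refl x
        ; sym   = λ {x} {y} → Θ-sym {x} {y}
        ; trans = λ {x} {y} {z} → Θ-trans {x} {y} {z}
        }
      ; reflexive = λ {x} {y} → Θ-reflexive {x} {y}
      ; ∧-congʳ   = λ {x} {y} z (x⊑y , y⊑x) →
          ∧-mono {x} {y} {z} {z} x⊑y (⊑ᵂ-refl z) , ∧-mono {y} {x} {z} {z} y⊑x (⊑ᵂ-refl z)
      ; ∨-congʳ   = λ {x} {y} z (x⊑y , y⊑x) →
          ∨-mono {x} {y} {z} {z} x⊑y (⊑ᵂ-refl z) , ∨-mono {y} {x} {z} {z} y⊑x (⊑ᵂ-refl z)
      }

    Θ-project : ∀ x → x Θ proj₁ (project x)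
    Θ-project x = ⊑-project x , project-⊑ x

    project-cong : ∀ {x y} → x Θ y → project x T.≈ project y
    project-cong {x} {y} (x⊑y , y⊑x) = WL.antisym {proj₁ (project x)} {proj₁ (project y)}
      (project-mono {x} {y} x⊑y) (project-mono {y} {x} y⊑x)

    project-avoiding : ∀ y → project (proj₁ y) T.≈ y
    project-avoiding y = WL.antisym {proj₁ (project (proj₁ y))} {proj₁ y}
      (π≤ (proj₁ (proj₁ y))) (avoiding-⊑⇒≤ y (proj₁ (project (proj₁ y))) (⊑-project (proj₁ y)))

-- In one-line notation with values from 0, and with the blocks 0 | 12 | 3 of
-- positions, the avoiding permutations 2130 and 3021 have the meet 2031.

module Counterexample where

  J : Subset 3
  J = outside ∷ inside ∷ outside ∷ []

  fromOneLine : (w w⁻¹ : Vec (Fin 4) 4) →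
                {True (all? (λ i → lookup w (lookup w⁻¹ i) ≟ i))} →
                {True (all? (λ i → lookup w⁻¹ (lookup w i) ≟ i))} → Permutation′ 4
  fromOneLine w w⁻¹ {r} {l} = Perm.permutation (lookup w) (lookup w⁻¹) (toWitness r) (toWitness l)

  u v h : Permutation′ 4
  u = fromOneLine (2F ∷ 1F ∷ 3F ∷ 0F ∷ []) (3F ∷ 1F ∷ 0F ∷ 2F ∷ [])
  v = fromOneLine (3F ∷ 0F ∷ 2F ∷ 1F ∷ []) (1F ∷ 3F ∷ 2F ∷ 0F ∷ [])
  h = fromOneLine (2F ∷ 0F ∷ 3F ∷ 1F ∷ []) (1F ∷ 3F ∷ 0F ∷ 2F ∷ [])

  inParabolicQuotient? : ∀ w → Dec (InParabolicQuotient J w)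
  inParabolicQuotient? w = all? λ i → i ∈? J →-dec (w ⟨$⟩ʳ inject₁ i) <? (w ⟨$⟩ʳ suc i)

  Pattern : Permutation′ 4 → Fin 4 → Fin 4 → Fin 4 → Set
  Pattern w i j k = (i < j × j < k) × Separated J i j k ×
    ((w ⟨$⟩ʳ i) < (w ⟨$⟩ʳ j) × toℕ (w ⟨$⟩ʳ i) ≡ suc (toℕ (w ⟨$⟩ʳ k)))

  noPattern? : ∀ w → Dec (∀ i j k → ¬ Pattern w i j k)
  noPattern? w = all? λ i → all? λ j → all? λ k → ¬?
    ((i <? j ×-dec j <? k) ×-dec Separated? J i j k ×-dec
      ((w ⟨$⟩ʳ i) <? (w ⟨$⟩ʳ j) ×-dec toℕ (w ⟨$⟩ʳ i) ℕ.≟ suc (toℕ (w ⟨$⟩ʳ k))))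

  noPattern⇒Avoids231 : ∀ {w} → (∀ i j k → ¬ Pattern w i j k) → ¬ Contains231 J w
  noPattern⇒Avoids231 none = Avoids⇒Avoids231 J
    λ i<j j<k sep wᵢ<wⱼ eq → none _ _ _ ((i<j , j<k) , sep , wᵢ<wⱼ , eq)

  u∈ : ParabolicQuotient J
  u∈ = u , from-yes (inParabolicQuotient? u)

  v∈ : ParabolicQuotient J
  v∈ = v , from-yes (inParabolicQuotient? v)

  -- An intersection of inversion sets need not be an inversion set. Here it is the one of `h`,
  -- which identifies `h` as the meet.
  Inv-h⇔ : ∀ i j → (Inv h i j → Inv u i j × Inv v i j) × (Inv u i j × Inv v i j → Inv h i j)
  Inv-h⇔ = from-yes (all? λ i → all? λ j →
    (Inv? h i j →-dec (Inv? u i j ×-dec Inv? v i j)) ×-dec ((Inv? u i j ×-dec Inv? v i j) →-dec Inv? h i j))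

  h≈u⊓v : h Perm.≈ u ⊓ v
  h≈u⊓v = ≤S-antisym {u = h} {u ⊓ v}
    (⊓-greatest u v (Inv-cotransitive h) (λ p → proj₁ (proj₁ (Inv-h⇔ _ _) p)) (λ p → proj₂ (proj₁ (Inv-h⇔ _ _) p)))
    (λ p → proj₂ (Inv-h⇔ _ _) (x⊓z≤x u v p , x⊓z≤z u v p))

  u⊓v-contains231 : Contains231 J (u ⊓ v)
  u⊓v-contains231 = record
    -- In `h` these positions carry the values 2, 3, 1 and lie one in each block.
    { i       = 0F
    ; j       = 2F
    ; k       = 3F
    ; i<j     = ℕ.z<s
    ; j<k     = ℕ.s<s (ℕ.s<s ℕ.z<s)
    ; rᵢ≢rⱼ   = λ ()
    ; rⱼ≢rₖ   = λ ()
    ; rᵢ≢rₖ   = λ ()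
    ; wₖ<wᵢ   = subst₂ _<_ (h≈u⊓v 3F) (h≈u⊓v 0F) (ℕ.s<s ℕ.z<s)
    ; wᵢ<wⱼ   = subst₂ _<_ (h≈u⊓v 0F) (h≈u⊓v 2F) (ℕ.s<s (ℕ.s<s ℕ.z<s))
    ; wᵢ≡wₖ+1 = subst₂ (λ a b → toℕ a ≡ suc (toℕ b)) (h≈u⊓v 0F) (h≈u⊓v 3F) refl
    }

  ¬isSublattice : ¬ IsSublattice (LatticeOrder.lattice (weakIsLattice J)) (Avoids231 J)
  ¬isSublattice closed = proj₁ (closed u∈ v∈
    (noPattern⇒Avoids231 (from-yes (noPattern? u))) (noPattern⇒Avoids231 (from-yes (noPattern? v))))
    u⊓v-contains231

theorem1p1 : ((m : ℕ) (J : Subset m) →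
    Σ[ W ∈ WeakIsLattice J ] Σ[ T ∈ TamariIsLattice J ] IsLatticeQuotientOf T W)
    ×
    (Σ[ m ∈ ℕ ] Σ[ J ∈ Subset m ] Σ[ W ∈ WeakIsLattice J ]
    ¬ IsSublattice (LatticeOrder.lattice W) (Avoids231 J))
theorem1p1 = (λ m J → weakIsLattice J , tamariIsLattice J , tamariIsLatticeQuotient J)
           , (3 , J , weakIsLattice J , ¬isSublattice)
  where
  open Counterexample
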